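{- For every pair of positive integers $l$ and $r$, there exists a graph $G$ of order $lr$ that admits a regular distance $l$-labeling of degree $r$.
   Context: All graphs are finite and simple; $d(u,v)$ denotes the usual graph distance. For integers $m\le n$, $[m,n]=\{m,m+1,\ldots,n\}$. For a graph $G$ and a positive integer $l$, a distance $l$-labeling of $G$ is a function $f:V(G)\to[0,l]$ such that (i) $f(V(G))=[0,l]$ or $f(V(G))=[1,l]$, and (ii) whenever two distinct vertices $u,v$ satisfy $f(u)=f(v)=k$, we have $d(u,v)=k$. A distance $l$-labeling is regular of degree $r$ if for every $k\in[1,l]$ there are exactly $r$ vertices labeled $k$. -}

module Defs where

open import Data.Nat using (ℕ; zero; suc; _≤_)
open import Data.Fin using (Fin)
open import Data.Product using (_×_; ∃-syntax)
open import Data.Sum using (_⊎_)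
open import Function.Bundles using (_↔_)
open import Level using (0ℓ)
open import Relation.Binary.Core using (Rel)
open import Relation.Binary.Definitions using (Symmetric; Irreflexive; Decidable)
open import Relation.Binary.PropositionalEquality using (_≡_; _≢_)
open import Relation.Unary using (Pred; _∈_; _≐_)

record Graph : Set₁ where
  field
    order : ℕ

  Vertex : Set
  Vertex = Fin order

  field
    _~_      : Rel Vertex 0ℓ
    ~-sym    : Symmetric _~_
    ~-irrefl : Irreflexive _≡_ _~_
    _~?_     : Decidable _~_

open Graph public using (order; Vertex)

data Walk (G : Graph) : Vertex G → Vertex G → ℕ → Set where
  nil  : ∀ {u} → Walk G u u zero
  cons : ∀ {u v w n} → Graph._~_ G u v → Walk G v w n → Walk G u w (suc n)

-- d(u,v) = k. A relation rather than a function, since d(u,v) is infinite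
-- (related to no k) when u and v lie in different components.
-- A walk of minimum length is automatically a path.
Dist : (G : Graph) → Vertex G → Vertex G → ℕ → Set
Dist G u v k = Walk G u v k × (∀ n → Walk G u v n → k ≤ n)

[_⋯_] : ℕ → ℕ → Pred ℕ 0ℓ
[ m ⋯ n ] k = m ≤ k × k ≤ n

Image : ∀ {A : Set} → (A → ℕ) → Pred ℕ 0ℓ
Image f k = ∃[ x ] f x ≡ k

record IsDistanceLabeling (G : Graph) (l : ℕ) (f : Vertex G → ℕ) : Set where
  field
    bounded  : ∀ v → f v ∈ [ 0 ⋯ l ]
    image    : (Image f ≐ [ 0 ⋯ l ]) ⊎ (Image f ≐ [ 1 ⋯ l ])
    distance : ∀ k u v → u ≢ v → f u ≡ k → f v ≡ k → Dist G u v k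

IsRegular : (G : Graph) (l r : ℕ) (f : Vertex G → ℕ) → Set
IsRegular G l r f = ∀ k → k ∈ [ 1 ⋯ l ] → Fin r ↔ (∃[ v ] f v ≡ k)

{-# OPTIONS --safe #-}

-- Take r legs, with one vertex (a , i) on leg i for each level a < l, labeled
-- a + 1. Join (a , i) to (a + 2 , i), make level 0 a clique, and join the single
-- hub (0 , 0) to all of level 1. Then (a , i) and (a , j) with i ≠ j are joined
-- by going down in steps of two levels, crossing between the legs by one clique
-- edge (a even) or through the hub (a odd), and going up again: a + 1 edges.
-- No walk is shorter: by induction, a walk of length n from (b , i) to (a , j)
-- has a ≤ b + 2n, and even a + b + 1 ≤ 2n when i ≠ j, because the level changes
-- by at most 2 along an edge and legs are only changed at levels 0 and 1. For
-- b = a and i ≠ j this gives 2a < 2n.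
module Submission where

open import Defs
open import Data.Nat using (ℕ; zero; suc; _+_; _*_; _≤_; _<_; z≤n; s≤s)
open import Data.Nat.Properties
  using (_≟_; ≤-trans; m≤m+n; m≤n+m; m≤n⇒m≤1+n; m≤n⇒m≤o+n; <⇒≤; +-suc; +-mono-≤
        ; +-identityʳ; *-comm; *-cancelʳ-<; ≡-irrelevant; suc-injective; m≢1+n+m)
open import Data.Fin using (Fin; zero; toℕ; fromℕ<; combine; remQuot)
open import Data.Fin.Properties
  using (remQuot-combine; combine-remQuot; toℕ-fromℕ<; fromℕ<-toℕ; toℕ<n)
  renaming (_≟_ to _≟ᶠ_)
open import Data.Product using (_×_; ∃-syntax; _,_; map₁; proj₁; proj₂)
open import Data.Product.Properties using (Σ-≡,≡→≡)
open import Data.Sum using (_⊎_; inj₁; inj₂; swap)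
open import Function.Bundles using (mk↔ₛ′)
open import Relation.Binary.PropositionalEquality
  using (_≡_; _≢_; refl; sym; trans; cong; cong₂; subst; subst₂)
open import Relation.Nullary using (Dec; yes; no; ¬_; contradiction)
open import Relation.Nullary.Decidable using (_×-dec_; _⊎-dec_; ¬?)

snoc : ∀ {G u v w n} → Walk G u v n → Graph._~_ G v w → Walk G u w (suc n)
snoc nil        e = cons e nil
snoc (cons d p) e = cons d (snoc p e)

module Legs (r : ℕ) where

  -- There are `suc r` legs, so that leg `zero` exists and can carry the hub. Levels are unbounded
  -- here; the cutoff `l` enters only with `G`.
  Position : Set
  Position = ℕ × Fin (suc r)

  Step : Position → Position → Set
  Step (a , i) (b , j) = (a ≡ 0 × b ≡ 0 × i ≢ j)
                       ⊎ (a ≡ 0 × b ≡ 1 × i ≡ zero)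
                       ⊎ (b ≡ 2 + a × i ≡ j)

  pattern clique i≢j = inj₁ (refl , refl , i≢j)
  pattern hub        = inj₂ (inj₁ (refl , refl , refl))
  pattern leg        = inj₂ (inj₂ (refl , refl))

  step? : ∀ x y → Dec (Step x y)
  step? (a , i) (b , j) = (a ≟ 0 ×-dec b ≟ 0 ×-dec ¬? (i ≟ᶠ j))
                    ⊎-dec (a ≟ 0 ×-dec b ≟ 1 ×-dec i ≟ᶠ zero)
                    ⊎-dec (b ≟ 2 + a ×-dec i ≟ᶠ j)

  step-irrefl : ∀ {x} → ¬ Step x x
  step-irrefl (clique i≢i)                = i≢i refl
  step-irrefl (inj₂ (inj₁ (refl , () , _)))
  step-irrefl {a , _} (inj₂ (inj₂ (a≡2+a , _))) = m≢1+n+m a a≡2+a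

  Adjacent : Position → Position → Set
  Adjacent x y = Step x y ⊎ Step y x

  -- m stands for twice the length of a walk from (b , i) to (a , j).
  Reach : ℕ → Fin (suc r) → Position → ℕ → Set
  Reach a j (b , i) m = (i ≢ j → suc (b + a) ≤ m) × (i ≡ j → a ≤ b + m)

  -- The bound for different legs implies the one for equal legs, so the weaker one holds on any
  -- leg. It is what survives an edge that may change the leg.
  reach-≤ : ∀ {a j x m} → Reach a j x m → a ≤ proj₁ x + m
  reach-≤ {j = j} {b , i} {m} (far , near) with i ≟ᶠ j
  ... | yes i≡j = near i≡j
  ... | no  i≢j = ≤-trans (m≤n+m _ (suc b)) (≤-trans (far i≢j) (m≤n+m m b))

  reach-adjacent : ∀ {a j x y m} → Adjacent x y → Reach a j y m → Reach a j x (2 + m)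
  reach-adjacent (inj₁ (clique _)) h =
    (λ _ → s≤s (m≤n⇒m≤1+n (reach-≤ h))) , (λ _ → m≤n⇒m≤1+n (m≤n⇒m≤1+n (reach-≤ h)))
  reach-adjacent (inj₂ (clique _)) h =
    (λ _ → s≤s (m≤n⇒m≤1+n (reach-≤ h))) , (λ _ → m≤n⇒m≤1+n (m≤n⇒m≤1+n (reach-≤ h)))
  -- In both directions of a hub edge the bound for different legs is met without slack.
  reach-adjacent (inj₁ hub) h =
    (λ _ → s≤s (reach-≤ h)) , (λ _ → m≤n⇒m≤1+n (reach-≤ h))
  reach-adjacent (inj₂ hub) h =
    (λ _ → s≤s (s≤s (reach-≤ h))) , (λ _ → m≤n⇒m≤o+n 3 (reach-≤ h))
  reach-adjacent {a} {x = b , _} {m = m} (inj₁ leg) (far , near) =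
    (λ i≢j → ≤-trans (m≤n+m _ 2) (m≤n⇒m≤o+n 2 (far i≢j))) ,
    (λ i≡j → subst (a ≤_) 2+b+m≡b+2+m (near i≡j))
    where
    2+b+m≡b+2+m : 2 + b + m ≡ b + (2 + m)
    2+b+m≡b+2+m = sym (trans (+-suc b (suc m)) (cong suc (+-suc b m)))
  reach-adjacent {m = m} (inj₂ leg) (far , near) =
    (λ i≢j → s≤s (s≤s (far i≢j))) ,
    (λ i≡j → ≤-trans (near i≡j) (+-mono-≤ (m≤n+m _ 2) (m≤n+m m 2)))

  module _ (l : ℕ) where

    position : Fin (l * suc r) → Position
    position v = map₁ toℕ (remQuot {l} (suc r) v)

    G : Graph
    G = record
      { order    = l * suc r
      ; _~_      = λ u v → Adjacent (position u) (position v)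
      ; ~-sym    = swap
      ; ~-irrefl = λ { refl (inj₁ s) → step-irrefl s ; refl (inj₂ s) → step-irrefl s }
      ; _~?_     = λ u v → step? (position u) (position v) ⊎-dec step? (position v) (position u)
      }

    level : Vertex G → ℕ
    level v = proj₁ (position v)

    legOf : Vertex G → Fin (suc r)
    legOf v = proj₂ (position v)

    level<l : ∀ v → level v < l
    level<l v = toℕ<n (proj₁ (remQuot {l} (suc r) v))

    at : ∀ {a} → .(a < l) → Fin (suc r) → Vertex G
    at a<l i = combine (fromℕ< a<l) i

    position-at : ∀ {a} .(a<l : a < l) i → position (at a<l i) ≡ (a , i)
    position-at a<l i =
      trans (cong (map₁ toℕ) (remQuot-combine (fromℕ< a<l) i)) (cong (_, i) (toℕ-fromℕ< a<l))

    at-position : ∀ {a v} .(a<l : a < l) → level v ≡ a → at a<l (legOf v) ≡ v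
    at-position {v = v} a<l refl =
      trans (cong (λ k → combine k (legOf v)) (fromℕ<-toℕ _ a<l)) (combine-remQuot {l} (suc r) v)

    -- Level and leg determine a vertex through `at`.
    legs-differ : ∀ {u v} → level u ≡ level v → u ≢ v → legOf u ≢ legOf v
    legs-differ {u} {v} eq u≢v i≡j = u≢v
      (trans (sym (at-position a<l eq)) (trans (cong (at a<l) i≡j) (at-position a<l refl)))
      where a<l = level<l v

    adjacent-at : ∀ {a b i j} .(a<l : a < l) .(b<l : b < l) → Adjacent (a , i) (b , j) →
                  Graph._~_ G (at a<l i) (at b<l j)
    adjacent-at a<l b<l = subst₂ Adjacent (sym (position-at a<l _)) (sym (position-at b<l _))

    walk-at : ∀ {i j} a (a<l : a < l) → i ≢ j → Walk G (at a<l i) (at a<l j) (suc a)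
    walk-at zero a<l i≢j = cons (adjacent-at a<l a<l (inj₁ (clique i≢j))) nil
    -- The hub is joined to level 1 of every leg, its own included, so `i` or `j` may be `zero`.
    -- Since `m < n` is `suc m ≤ n`, `<⇒≤` lowers the level by one.
    walk-at (suc zero) a<l i≢j =
      cons (adjacent-at a<l (<⇒≤ a<l) (inj₂ hub))
        (cons (adjacent-at (<⇒≤ a<l) a<l (inj₁ hub)) nil)
    walk-at (suc (suc a)) a<l i≢j =
      cons (adjacent-at a<l b<l (inj₂ leg))
        (snoc (walk-at a b<l i≢j) (adjacent-at b<l a<l (inj₁ leg)))
      where
      b<l : a < l
      b<l = <⇒≤ (<⇒≤ a<l)

    -- Written `n * 2` because `suc n * 2` computes to `2 + n * 2`, the form that `reach-adjacent`
    -- yields.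
    walk-reach : ∀ {u v n} → Walk G u v n → Reach (level v) (legOf v) (position u) (n * 2)
    walk-reach nil        = (λ i≢i → contradiction refl i≢i) , (λ _ → m≤m+n _ 0)
    walk-reach (cons e w) = reach-adjacent e (walk-reach w)

    level<length : ∀ {u v n} → level u ≡ level v → u ≢ v → Walk G u v n → level v < n
    level<length {u} {v} {n} eq u≢v w =
      *-cancelʳ-< 2 (level v) n (subst (_< n * 2) double (proj₁ (walk-reach w) (legs-differ eq u≢v)))
      where
      double : level u + level v ≡ level v * 2
      double = trans (cong₂ _+_ eq (sym (+-identityʳ _))) (*-comm 2 (level v))

    label : Vertex G → ℕ
    label v = suc (level v)

    label-at : ∀ {a} .(a<l : a < l) i → label (at a<l i) ≡ suc a
    label-at a<l i = cong (λ x → suc (proj₁ x)) (position-at a<l i)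

    label-distance : ∀ {k u v} → u ≢ v → label u ≡ k → label v ≡ k → Dist G u v k
    label-distance {u = u} {v} u≢v eq refl =
      subst₂ (λ x y → Walk G x y (label v)) (at-position a<l u-level) (at-position a<l refl)
        (walk-at (level v) a<l (legs-differ u-level u≢v)) ,
      λ n → level<length u-level u≢v
      where
      a<l = level<l v
      u-level = suc-injective eq

    label-isDistanceLabeling : IsDistanceLabeling G l label
    label-isDistanceLabeling = record
      { bounded  = λ v → z≤n , level<l v
      -- Labels are levels plus one, hence start at 1. Leg `zero` supplies a vertex for each label.
      ; image    = inj₂ ( (λ { (v , refl) → s≤s z≤n , level<l v })
                        , (λ { {suc a} (_ , a<l) → at a<l zero , label-at a<l zero }))
      ; distance = λ k u v → label-distance
      }

    label-isRegular : IsRegular G l (suc r) label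
    label-isRegular (suc a) (_ , a<l) = mk↔ₛ′
      (λ i → at a<l i , label-at a<l i)
      (λ (v , _) → legOf v)
      -- Equality proofs in `ℕ` are unique, so a point of the fibre is just its vertex.
      (λ (v , eq) → Σ-≡,≡→≡ (at-position a<l (suc-injective eq) , ≡-irrelevant _ _))
      (λ i → cong proj₂ (position-at a<l i))

mainTheorem5 : (l r : ℕ) → 0 < l → 0 < r →
    ∃[ G ] (order G ≡ l * r × ∃[ f ] (IsDistanceLabeling G l f × IsRegular G l r f))
mainTheorem5 l (suc r) _ _ =
  G l , refl , label l , label-isDistanceLabeling l , label-isRegular l
  where open Legs r
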